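{- There exist exponentially many words over the ternary alphabet $\{0,1,2\}$ satisfying each of the following properties; that is, for each of (a), (b), (c) there is a real constant $c_0>1$ such that, for all sufficiently large $n$, at least $c_0^n$ ternary words of length $n$ have the property: (a) being $\tfrac{15}{8}^+$-free and avoiding the letter pattern $abaca$; (b) being $\tfrac{11}{6}^+$-free and avoiding the letter pattern $abcab$; (c) being $\tfrac{7}{4}^+$-free and avoiding the letter pattern $abacbc$.
   Context: For a nonempty finite word $u$ and a rational $r>1$, a word $v$ is an $r$-power (of $u$) if $v$ is a prefix of the infinite periodic word $uuu\cdots$ and $|v|/|u|=r$. A word is $\beta^+$-free if none of its factors is an $r$-power with $r>\beta$. A letter pattern is a finite word over variables $a,b,c,\dots$ in which each variable stands for one letter and different variables stand for different letters; a ternary word avoids a letter pattern if none of its factors is obtained from the pattern by substituting pairwise distinct letters of $\{0,1,2\}$ for the variables. For example, the occurrences of $abaca$ are $01020, 02010, 10121, 12101, 20212, 21202$. -}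

module Defs where

open import Data.Fin.Base using (Fin; toℕ)
open import Data.Integer.Base using (+_)
open import Data.List.Base using (List; []; _∷_; length; lookup; map)
open import Data.List.Membership.Propositional using (_∈_)
open import Data.List.NonEmpty.Base as List⁺ using (List⁺)
open import Data.List.Relation.Binary.Infix.Heterogeneous using (Infix)
open import Data.List.Relation.Unary.All using (All)
open import Data.List.Relation.Unary.Unique.Propositional using (Unique)
open import Data.Nat.Base using (ℕ; _≥_)
open import Data.Nat.DivMod using (_mod_)
open import Data.Product.Base using (_×_; ∃-syntax)
open import Data.Rational.Base using (ℚ; 1ℚ; _/_; _<_; _>_; _≤_; +-*-rawSemiring)
open import Relation.Binary.PropositionalEquality.Core using (_≡_)
open import Relation.Nullary.Negation.Core using (¬_)

open import Algebra.Definitions.RawSemiring +-*-rawSemiring using (_^_)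

Word : Set → Set
Word = List

infix 4 _IsFactorOf_ _IsPrefixOf_

_IsFactorOf_ : {A : Set} → Word A → Word A → Set
_IsFactorOf_ = Infix _≡_

InfiniteWord : Set → Set
InfiniteWord A = ℕ → A

_IsPrefixOf_ : {A : Set} → Word A → InfiniteWord A → Set
v IsPrefixOf x = ∀ (i : Fin (length v)) → lookup v i ≡ x (toℕ i)

_^ω : {A : Set} → List⁺ A → InfiniteWord A
(u ^ω) i = lookup (List⁺.toList u) (i mod List⁺.length u)

_IsPowerOf_withExponent_ : {A : Set} → Word A → List⁺ A → ℚ → Set
v IsPowerOf u withExponent r =
  r > 1ℚ × v IsPrefixOf (u ^ω) × (+ length v) / List⁺.length u ≡ r

_⁺-Free : ℚ → {A : Set} → Word A → Set
(β ⁺-Free) w =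
  ∀ v u r → v IsFactorOf w → r > β → ¬ (v IsPowerOf u withExponent r)

Variable : Set
Variable = ℕ

LetterPattern : Set
LetterPattern = List Variable

-- Only the variables that occur in the pattern have to receive distinct
-- letters; the values of σ elsewhere are irrelevant.
_IsOccurrenceOf_ : {A : Set} → Word A → LetterPattern → Set
_IsOccurrenceOf_ {A} v p =
  ∃[ σ ] (∀ {x y} → x ∈ p → y ∈ p → σ x ≡ σ y → x ≡ y) × v ≡ map {B = A} σ p

_Avoids_ : {A : Set} → Word A → LetterPattern → Set
w Avoids p = ∀ v → v IsFactorOf w → ¬ (v IsOccurrenceOf p)

pattern a = 0
pattern b = 1
pattern c = 2

abaca abcab abacbc : LetterPattern
abaca  = a ∷ b ∷ a ∷ c ∷ a ∷ []
abcab  = a ∷ b ∷ c ∷ a ∷ b ∷ []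
abacbc = a ∷ b ∷ a ∷ c ∷ b ∷ c ∷ []

-- A duplicate-free list of words witnesses a lower bound on their number.
AtLeast_WordsOfLength_With_ : {A : Set} → ℚ → ℕ → (Word A → Set) → Set
AtLeast_WordsOfLength_With_ {A} x n P =
  ∃[ ws ] Unique ws × All (λ (w : Word A) → length w ≡ n × P w) ws
        × x ≤ (+ length ws) / 1

-- The growth constant is rational: below every real c₀ > 1 there is a
-- rational one that is still > 1, so nothing is lost by this.
ExponentiallyMany : {A : Set} → (Word A → Set) → Set
ExponentiallyMany P =
  ∃[ c₀ ] c₀ > 1ℚ × (∃[ N ] ∀ n → n ≥ N → AtLeast (c₀ ^ n) WordsOfLength n With P)

{-# OPTIONS --safe #-}

-- Let x be a stream over four letters in which every overlap e of a repetition
-- with period k satisfies 2e + 1 ≤ k; then any three consecutive letters of x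
-- are distinct.  A q-uniform map h whose images are synchronizing turns such an
-- x into a stream all of whose repetitions are either short, and found in the
-- images of a few factors, or have a period k q.  In the latter case the
-- overlap consists of full blocks, which repeat in x, and of at most E₁ + E₂
-- further letters, where E₁ and E₂ bound the common prefixes and suffixes of
-- images of distinct letters.  The gap between 1/2 and N/D, the admitted ratio
-- of overlap and period, absorbs these letters, so that the image is free of
-- repetitions with exponent above 1 + N/D.
--
-- This applies to a map g from four letters to four letters with two images
-- for each letter.  It preserves the class of the streams x above, the slack + 1
-- taking the role of the gap; iterating it gives a stream x, and all choices of
-- images in one more application give 2 ^ m streams that differ in their first
-- 102 m letters.  Three maps hᵃ, hᵇ, hᶜ to ternary words transfer them to the
-- three properties; the letter patterns are so short that looking at images of
-- two letters suffices.
module Submission where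

open import Defs hiding (a; b; c)
open import Algebra.Bundles using (module CommutativeMonoid)
open import Algebra.Definitions.RawSemiring using () renaming (_^_ to pow)
open import Data.Bool.Base using (Bool; true; false; T; not; _∧_; _∨_; if_then_else_)
open import Data.Bool.ListAction using (all)
open import Data.Bool.Properties using (T-∧; T-∨; T?)
import Data.Char.Base as Char
open import Data.Empty using (⊥-elim)
open import Data.Fin.Base as Fin using (Fin; zero; suc; toℕ; fromℕ<; funToFin; finToFun)
open import Data.Fin.Patterns using (0F; 1F; 2F; 3F)
open import Data.Fin.Properties
  using (_≟_; funToFin-finToFin; toℕ-fromℕ<; fromℕ<-cong; fromℕ<-injective; toℕ<n; fromℕ<-toℕ)
import Data.Integer.Base as ℤ
import Data.Integer.Properties as ℤ
open import Data.List.Base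
  using (List; []; _∷_; _++_; allFin; applyUpTo; cartesianProduct; concatMap; drop; filterᵇ; length; lookup; map)
open import Data.List.Membership.Propositional using (_∈_; lose)
open import Data.List.Membership.Propositional.Properties
  using (∈-allFin; ∈-applyUpTo⁺; ∈-cartesianProduct⁺; ∈-concatMap⁺; ∈-filter⁺; ∈-map⁺)
open import Data.List.NonEmpty.Base as List⁺ using (_∷_)
open import Data.List.Properties
  using (∷-injectiveˡ; ∷-injectiveʳ; length-applyUpTo; length-map; lookup-applyUpTo; length-tabulate)
open import Data.List.Relation.Binary.Infix.Heterogeneous using (here; there)
open import Data.List.Relation.Binary.Prefix.Heterogeneous using (Prefix; []; _∷_)
open import Data.List.Relation.Unary.All as All using (All)
import Data.List.Relation.Unary.All.Properties as All
open import Data.List.Relation.Unary.Any using (here; there)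
open import Data.List.Relation.Unary.Unique.Propositional.Properties as Unique using (allFin⁺)
open import Data.Nat.Base
open import Data.Nat.Divisibility using (n∣m*n)
open import Data.Nat.DivMod
open import Data.Nat.Properties hiding (_≟_)
open import Data.Nat.Tactic.RingSolver using (solve-∀)
open import Data.Product.Base using (_×_; _,_; proj₁; proj₂; ∃-syntax)
open import Data.Product.Properties using (≡-dec; ,-injectiveʳ)
open import Data.Rational.Base as ℚ using (ℚ)
open import Data.Rational.Properties as ℚ using (toℚᵘ-fromℚᵘ)
open import Data.Rational.Unnormalised.Base as ℚᵘ using (mkℚᵘ; *≤*; *<*; *≡*)
import Data.Rational.Unnormalised.Properties as ℚᵘ
open import Data.String.Base using (String; toList)
open import Data.Sum.Base using (_⊎_; inj₁; inj₂)
open import Data.Unit.Base using (tt)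
open import Function.Base using (_∘_; id)
open import Function.Bundles using (Equivalence)
open import Relation.Binary.Definitions using (DecidableEquality)
open import Relation.Binary.PropositionalEquality
open import Relation.Nullary using (¬_; Dec; does; yes; no; contradiction)
open import Relation.Nullary.Decidable using (dec-true)

open import Algebra.Properties.CommutativeSemigroup +-commutativeSemigroup using (xy∙z≈xz∙y)

private variable
  A : Set
  r : ℕ

-- Words and streams

T-not : ∀ {x} → T (not x) → ¬ T x
T-not {false} _ ()

∧-intro : ∀ {x y} → T x → T y → T (x ∧ y)
∧-intro p q = Equivalence.from T-∧ (p , q)

∨-introˡ : ∀ {x y} → T x → T (x ∨ y)
∨-introˡ p = Equivalence.from T-∨ (inj₁ p)

∨-introʳ : ∀ {x y} → T y → T (x ∨ y)
∨-introʳ p = Equivalence.from T-∨ (inj₂ p)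

T-does : {P : Set} (P? : Dec P) → P → T (does P?)
T-does (yes _) _ = tt
T-does (no ¬p) p = ¬p p

does-T : {P : Set} (P? : Dec P) → T (does P?) → P
does-T (yes p) _ = p

all-lookup : ∀ (f : A → Bool) {xs x} → T (all f xs) → x ∈ xs → T (f x)
all-lookup f ok = All.lookup (All.all⁺ f _ ok)

applyUpTo-cong : ∀ {f g : ℕ → A} n → (∀ i → i < n → f i ≡ g i) → applyUpTo f n ≡ applyUpTo g n
applyUpTo-cong zero    _  = refl
applyUpTo-cong (suc n) eq =
  cong₂ _∷_ (eq 0 z<s) (applyUpTo-cong n (λ i i<n → eq (suc i) (s<s i<n)))

applyUpTo-++ : ∀ (f : ℕ → A) m n → applyUpTo f (m + n) ≡ applyUpTo f m ++ applyUpTo (λ i → f (m + i)) n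
applyUpTo-++ f zero    n = refl
applyUpTo-++ f (suc m) n = cong (f 0 ∷_) (applyUpTo-++ (f ∘ suc) m n)

applyUpTo-injective : ∀ {f g : ℕ → A} n → applyUpTo f n ≡ applyUpTo g n → ∀ i → i < n → f i ≡ g i
applyUpTo-injective (suc n) eq zero    _   = ∷-injectiveˡ eq
applyUpTo-injective (suc n) eq (suc i) i<n =
  applyUpTo-injective n (∷-injectiveʳ eq) i (s<s⁻¹ i<n)

infix 8 _‼_
-- Junk value zero beyond the end of the word.
_‼_ : Word (Fin (suc r)) → ℕ → Fin (suc r)
[]       ‼ _     = zero
(x ∷ _)  ‼ zero  = x
(_ ∷ xs) ‼ suc i = xs ‼ i

applyUpTo-‼ : ∀ (xs : Word (Fin (suc r))) → applyUpTo (xs ‼_) (length xs) ≡ xs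
applyUpTo-‼ []       = refl
applyUpTo-‼ (x ∷ xs) = cong (x ∷_) (applyUpTo-‼ xs)

drop-applyUpTo : ∀ (f : ℕ → A) k n → drop k (applyUpTo f (k + n)) ≡ applyUpTo (λ i → f (k + i)) n
drop-applyUpTo f zero    n = refl
drop-applyUpTo f (suc k) n = drop-applyUpTo (f ∘ suc) k n

-- Boolean tests on finite words and their correctness

agree : ℕ → Word (Fin r) → Word (Fin r) → Bool
agree zero    _        _        = true
agree (suc m) (x ∷ xs) (y ∷ ys) = does (x ≟ y) ∧ agree m xs ys
agree (suc m) _        _        = false

overlaps : ℕ → ℕ → Word (Fin r) → Word (Fin r) → Bool
overlaps m (suc n) xs@(_ ∷ xs′) ys@(_ ∷ ys′) = agree m xs ys ∨ overlaps m n xs′ ys′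
overlaps _ _       _            _            = false

-- Only repetitions that start in the first n positions are looked for; excess p
-- is the smallest forbidden overlap for the period p.
repetitionFree : (ℕ → ℕ) → ℕ → List ℕ → Word (Fin r) → Bool
repetitionFree excess n ps xs = all (λ p → not (overlaps (excess p) n xs (drop p xs))) ps

offsets : ℕ → ℕ → Word A → List (ℕ × Word A)
offsets zero    _ _            = []
offsets (suc n) i xs@(_ ∷ ys)  = (i , xs) ∷ offsets n (suc i) ys
offsets (suc n) i []           = []

constant : List (ℕ × Word A) → Bool
constant []             = true
constant ((i , _) ∷ xs) = all (λ (j , _) → i ≡ᵇ j) xs

peel : Fin r → List (ℕ × Word (Fin r)) → List (ℕ × Word (Fin r))
peel x []                 = []
peel x ((i , []) ∷ s)     = peel x s
peel x ((i , y ∷ ys) ∷ s) = if does (y ≟ x) then (i , ys) ∷ peel x s else peel x s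

-- Labelled words that share a prefix of length n have the same label; splitting
-- by first letters avoids the comparison of all pairs.
prefixDetermined : ℕ → List (ℕ × Word (Fin r)) → Bool
prefixDetermined zero    s = constant s
prefixDetermined (suc n) s = constant s ∨ all (λ x → prefixDetermined n (peel x s)) (allFin _)

same : Bool → Bool → Bool
same true  y = y
same false y = not y

-- A word is an occurrence of a pattern if two of its letters agree exactly when
-- the two variables do.
alike : ℕ → LetterPattern → Fin r → Word (Fin r) → Bool
alike v []       x _        = true
alike v (w ∷ ws) x (y ∷ ys) = same (v ≡ᵇ w) (does (x ≟ y)) ∧ alike v ws x ys
alike v (w ∷ ws) x []       = false

startsWith : LetterPattern → Word (Fin r) → Bool
startsWith []       _        = true
startsWith (v ∷ vs) (x ∷ xs) = alike v vs x xs ∧ startsWith vs xs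
startsWith (v ∷ vs) []       = false

contains : LetterPattern → ℕ → Word (Fin r) → Bool
contains p zero    _            = false
contains p (suc n) []           = false
contains p (suc n) xs@(_ ∷ ys)  = startsWith p xs ∨ contains p n ys

-- Certificates use `agree` and `overlaps` under `not`, so only the direction from an actual
-- coincidence to a positive answer matters. Running out of letters counts as disagreement, hence
-- the bounds on lengths.
agree-complete : ∀ {f g : ℕ → Fin r} {m k l} → m ≤ k → m ≤ l → (∀ i → i < m → f i ≡ g i) →
                 T (agree m (applyUpTo f k) (applyUpTo g l))
agree-complete {m = zero}  _         _         _  = tt
agree-complete {f = f} {g} {suc m} (s≤s m≤k) (s≤s m≤l) eq =
  ∧-intro (T-does (f 0 ≟ g 0) (eq 0 z<s)) (agree-complete m≤k m≤l (λ i i<m → eq (suc i) (s<s i<m)))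

overlaps-complete : ∀ {f g : ℕ → Fin r} {m n k l} s → s < n → 1 ≤ m → s + m ≤ k → s + m ≤ l →
                    (∀ i → i < m → f (s + i) ≡ g (s + i)) →
                    T (overlaps m n (applyUpTo f k) (applyUpTo g l))
overlaps-complete {k = zero}  zero _ 1≤m m≤k _ _ = contradiction (≤-trans 1≤m m≤k) 1+n≰n
overlaps-complete {k = suc k} {zero} zero _ 1≤m _ m≤l _ = contradiction (≤-trans 1≤m m≤l) 1+n≰n
overlaps-complete {n = suc n} {suc k} {suc l} zero _ _ m≤k m≤l eq = ∨-introˡ (agree-complete m≤k m≤l eq)
overlaps-complete {n = suc n} {suc k} {suc l} (suc s) s<n 1≤m le le′ eq =
  ∨-introʳ (overlaps-complete s (s<s⁻¹ s<n) 1≤m (s≤s⁻¹ le) (s≤s⁻¹ le′) (λ i i<m → eq i i<m))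

repetitionFree-sound : ∀ {f : ℕ → Fin r} {excess n ps k p s} →
                       T (repetitionFree excess n ps (applyUpTo f k)) → p ∈ ps → s < n →
                       1 ≤ excess p → s + p + excess p ≤ k →
                       ¬ (∀ i → i < excess p → f (s + i) ≡ f (s + p + i))
repetitionFree-sound {f = f} {excess} {n} {k = k} {p} {s} free p∈ s<n 1≤m le eq =
  T-not (all-lookup (λ p → not (overlaps (excess p) n (applyUpTo f k) (drop p (applyUpTo f k)))) free p∈)
    (subst (λ ys → T (overlaps (excess p) n (applyUpTo f k) ys)) (sym dropped)
      (overlaps-complete s s<n 1≤m
        (≤-trans (+-monoˡ-≤ (excess p) (m≤m+n s p)) le)
        (m+n≤o⇒m≤o∸n (s + excess p) (≤-trans (≤-reflexive (xy∙z≈xz∙y s (excess p) p)) le))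
        (λ i i<m → trans (eq i i<m) (cong f (trans (cong (_+ i) (+-comm s p)) (+-assoc p s i))))))
  where
  p≤k : p ≤ k
  p≤k = ≤-trans (m≤n+m p s) (≤-trans (m≤m+n (s + p) _) le)
  dropped : drop p (applyUpTo f k) ≡ applyUpTo (λ i → f (p + i)) (k ∸ p)
  dropped = trans (cong (drop p ∘ applyUpTo f) (sym (m+[n∸m]≡n p≤k))) (drop-applyUpTo f p (k ∸ p))

∈-offsets : ∀ (f : ℕ → A) {n k} o s → s < n → n ≤ k →
            (o + s , applyUpTo (λ i → f (s + i)) (k ∸ s)) ∈ offsets n o (applyUpTo f k)
∈-offsets f {suc n} {suc k} o zero _ _ =
  here (cong (_, applyUpTo f (suc k)) (+-identityʳ o))
∈-offsets f {suc n} {suc k} o (suc s) s<n n≤k =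
  there (subst (λ z → (z , applyUpTo (λ i → f (suc s + i)) (k ∸ s)) ∈ offsets n (suc o) (applyUpTo (f ∘ suc) k))
    (sym (+-suc o s)) (∈-offsets (f ∘ suc) (suc o) s (s<s⁻¹ s<n) (s≤s⁻¹ n≤k)))

constant-sound : ∀ {s i j} {xs ys : Word A} → T (constant s) → (i , xs) ∈ s → (j , ys) ∈ s → i ≡ j
constant-sound {s = (k , _) ∷ s} ok i∈ j∈ = trans (sym (label i∈)) (label j∈)
  where
  label : ∀ {m zs} → (m , zs) ∈ ((k , _) ∷ s) → k ≡ m
  label (here refl) = refl
  label (there m∈)  = ≡ᵇ⇒≡ _ _ (all-lookup (λ (j , _) → k ≡ᵇ j) ok m∈)

∈-peel : ∀ {s i} (x : Fin r) {xs} → (i , x ∷ xs) ∈ s → (i , xs) ∈ peel x s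
∈-peel {s = (_ , x ∷ _) ∷ _} x (here refl) rewrite dec-true (x ≟ x) refl = here refl
∈-peel {s = (_ , []) ∷ _} x (there i∈) = ∈-peel x i∈
∈-peel {s = (_ , y ∷ _) ∷ _} x (there i∈) with does (y ≟ x)
... | true  = there (∈-peel x i∈)
... | false = ∈-peel x i∈

-- Two entries with a common prefix survive the same calls of `peel`, losing one common letter each
-- time, until they lie in one constant list. The bounds on `k` and `l` keep them from running out
-- of letters and being dropped.
prefixDetermined-sound : ∀ n {s i j k l} {f g : ℕ → Fin r} → T (prefixDetermined n s) → n ≤ k → n ≤ l →
                 (∀ t → t < n → f t ≡ g t) →
                 (i , applyUpTo f k) ∈ s → (j , applyUpTo g l) ∈ s → i ≡ j
prefixDetermined-sound zero ok _ _ _ i∈ j∈ = constant-sound ok i∈ j∈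
prefixDetermined-sound (suc n) {s} {f = f} {g} ok (s≤s n≤k) (s≤s n≤l) eq i∈ j∈
  with Equivalence.to (T-∨ {constant s}) ok
... | inj₁ const = constant-sound const i∈ j∈
... | inj₂ ok′   =
  prefixDetermined-sound n (all-lookup (λ x → prefixDetermined n (peel x s)) ok′ (∈-allFin (f 0))) n≤k n≤l
    (λ t t<n → eq (suc t) (s<s t<n)) (∈-peel (f 0) i∈)
    (∈-peel (f 0) (subst (λ y → (_ , y ∷ _) ∈ s) (sym (eq 0 z<s)) j∈))

alike-complete : ∀ (σ : Variable → Fin r) v ws zs → (∀ {w} → w ∈ ws → σ v ≡ σ w → v ≡ w) →
                 T (alike v ws (σ v) (map σ ws ++ zs))
alike-complete σ v []       zs inj = tt
alike-complete σ v (w ∷ ws) zs inj =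
  ∧-intro (here-ok (v ≡ᵇ w) refl) (alike-complete σ v ws zs (inj ∘ there))
  where
  here-ok : ∀ e → (v ≡ᵇ w) ≡ e → T (same e (does (σ v ≟ σ w)))
  here-ok true  eq = T-does (σ v ≟ σ w) (cong σ (≡ᵇ⇒≡ v w (subst T (sym eq) tt)))
  here-ok false eq with σ v ≟ σ w
  ... | yes σv≡σw = subst T eq (≡⇒≡ᵇ v w (inj (here refl) σv≡σw))
  ... | no  _     = tt

startsWith-complete : ∀ (σ : Variable → Fin r) p zs →
                      (∀ {v w} → v ∈ p → w ∈ p → σ v ≡ σ w → v ≡ w) →
                      T (startsWith p (map σ p ++ zs))
startsWith-complete σ []       zs inj = tt
startsWith-complete σ (v ∷ vs) zs inj =
  ∧-intro (alike-complete σ v vs zs (λ w∈ → inj (here refl) (there w∈)))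
          (startsWith-complete σ vs zs (λ v∈ w∈ → inj (there v∈) (there w∈)))

contains-complete : ∀ {f : ℕ → Fin r} p {n k} s → s < n → n ≤ k →
                    T (startsWith p (applyUpTo (λ i → f (s + i)) (k ∸ s))) →
                    T (contains p n (applyUpTo f k))
contains-complete p {suc n} {suc k} zero    _   _   st = ∨-introˡ st
contains-complete p {suc n} {suc k} (suc s) s<n n≤k st =
  ∨-introʳ (contains-complete p s (s<s⁻¹ s<n) (s≤s⁻¹ n≤k) st)

-- Uniform maps

Repeats : (ℕ → A) → ℕ → ℕ → ℕ → Set
Repeats x s p e = ∀ i → i < e → x (s + i) ≡ x (s + p + i)

-- A repetition with period p and overlap e has exponent 1 + e / p.  The slack κ
-- leaves room for common prefixes and suffixes in maps that preserve a class.
Bounded : ℕ → ℕ → ℕ → ℕ → (ℕ → A) → Set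
Bounded N D κ M x = ∀ s p e → 1 ≤ p → s + p + e ≤ M → Repeats x s p e → e * D + κ ≤ N * p

Bounded-≤ : ∀ N D κ (x : ℕ → A) {M M′} → M ≤ M′ → Bounded N D κ M′ x → Bounded N D κ M x
Bounded-≤ _ _ _ _ M≤M′ bnd s p e 1≤p le = bnd s p e 1≤p (≤-trans le M≤M′)

-- All exponents stay below 3/2, which four letters permit: their repetition threshold is 7/5.
SourceUpTo : ℕ → (ℕ → A) → Set
SourceUpTo = Bounded 1 2 1

-- Equal letters at distance d form a repetition of period d with overlap 1, which forces 3 ≤ d.
source-distinct : ∀ {M} {x : ℕ → A} → SourceUpTo M x →
                  ∀ i d → 1 ≤ d → d ≤ 2 → i + d < M → x i ≢ x (i + d)
source-distinct {x = x} src i d 1≤d d≤2 i+d<M xᵢ≡ =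
  contradiction (≤-trans (src i d 1 1≤d (≤-trans (≤-reflexive (+-comm (i + d) 1)) i+d<M) rep)
                         (≤-trans (≤-reflexive (*-identityˡ d)) d≤2)) λ { (s≤s (s≤s ())) }
  where
  rep : Repeats x i d 1
  rep zero _ = trans (cong x (+-identityʳ i)) (trans xᵢ≡ (cong x (sym (+-identityʳ (i + d)))))
  rep (suc _) (s≤s ())

-- For κ ≤ N p this is the least e with e D + κ > N p.
threshold : (N D κ : ℕ) → .{{NonZero D}} → ℕ → ℕ
threshold N D κ p = suc ((N * p ∸ κ) / D)

threshold-mono : ∀ N D κ .{{_ : NonZero D}} {p p′} → p ≤ p′ → threshold N D κ p ≤ threshold N D κ p′
threshold-mono N D κ p≤p′ = s≤s (/-monoˡ-≤ D (∸-monoˡ-≤ κ (*-monoʳ-≤ N p≤p′)))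

-- The letters of `C` may carry a choice of image that `π` forgets: the source condition concerns
-- `π ∘ w` only, while `h` depends on the choice.
module UniformMap
  {C : Set} {n : ℕ} (π : C → Fin n) (letters : List C) (complete : ∀ x → x ∈ letters)
  (q : ℕ) .{{q≢0 : NonZero q}} (h : C → Word (Fin (suc r)))
  where

  image : (ℕ → C) → ℕ → Fin (suc r)
  image w i = h (w (i / q)) ‼ (i % q)

  fresh : Word C → C → Bool
  fresh []          x = true
  fresh (y ∷ [])    x = not (does (π x ≟ π y))
  fresh (y ∷ z ∷ _) x = not (does (π x ≟ π y)) ∧ not (does (π x ≟ π z))

  -- A superset of the source factors of length `k`: of the source property, only the distinctness
  -- of three consecutive letters under `π` enters.
  factors : ℕ → List (Word C)
  factors zero    = [] ∷ []
  factors (suc k) = concatMap (λ u → map (_∷ u) (filterᵇ (fresh u) letters)) (factors k)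

  separated : ℕ → ℕ → Bool
  separated i m =
    all (λ x → all (λ y → does (π x ≟ π y) ∨ not (agree m (drop i (h x)) (drop i (h y)))) letters) letters

  windows : List (ℕ × Word (Fin (suc r)))
  windows = concatMap (λ u → offsets q 0 (concatMap h u)) (factors 2)

  freeUpTo : (ℕ → ℕ) → List ℕ → ℕ → Bool
  freeUpTo excess ps k = all (λ u → repetitionFree excess q ps (concatMap h u)) (factors k)

  -- P bounds the periods treated on images of k letters; above P, an overlap
  -- violating the bound has length at least L and determines residues modulo q.
  record Certificate (N D κ P L E₁ E₂ k : ℕ) .{{_ : NonZero D}} : Set where
    field
      uniform       : T (all (λ x → length (h x) ≡ᵇ q) letters)
      prefixes      : T (separated 0 (suc E₁))
      suffixes      : T (separated (q ∸ suc E₂) (suc E₂))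
      synchronizing : T (prefixDetermined L windows)
      shortPeriods  : T (freeUpTo (threshold N D κ) (applyUpTo suc P) k)
      blockPeriod   : T (freeUpTo (threshold N D κ) (q ∷ []) 3)
      κ≤N           : κ ≤ N
      κ≤D           : κ ≤ D
      D≤2N          : D ≤ 2 * N
      E₁<q          : E₁ < q
      E₂<q          : E₂ < q
      L≤1+q         : L ≤ suc q
      k≤3           : k ≤ 3
      P-large       : L * D + κ ≤ N * suc P + D
      k-window      : q + (P + threshold N D κ P) ≤ suc (k * q)
      3-window      : q + (q + threshold N D κ q) ≤ suc (3 * q)
      slack         : 2 * ((E₁ + E₂) * D + κ) + D * q ≤ 4 * N * q

  quot-shift : ∀ j i → (j * q + i) / q ≡ j + i / q
  quot-shift j i = trans (+-distrib-/-∣ˡ i (n∣m*n j)) (cong (_+ i / q) (m*n/n≡m j q))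

  rem-shift : ∀ j i → (j * q + i) % q ≡ i % q
  rem-shift j i = trans (cong (_% q) (+-comm (j * q) i)) ([m+kn]%n≡m%n i j q)

  image-shift : ∀ w j i → image w (j * q + i) ≡ image (λ t → w (j + t)) i
  image-shift w j i = cong₂ (λ u v → h (w u) ‼ v) (quot-shift j i) (rem-shift j i)

  image-block : ∀ w j i → i < q → image w (j * q + i) ≡ h (w j) ‼ i
  image-block w j i i<q = cong₂ (λ u v → h (w u) ‼ v)
    (trans (quot-shift j i) (trans (cong (j +_) (m<n⇒m/n≡0 i<q)) (+-identityʳ j)))
    (trans (rem-shift j i) (m<n⇒m%n≡m i<q))

  split : ∀ s → s ≡ (s / q) * q + s % q
  split s = trans (m≡m%n+[m/n]*n s q) (+-comm (s % q) _)

  image-split : ∀ w s i → image w (s + i) ≡ image (λ t → w (s / q + t)) (s % q + i)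
  image-split w s i = trans
    (cong (image w) (trans (cong (_+ i) (split s)) (+-assoc (s / q * q) (s % q) i)))
    (image-shift w (s / q) (s % q + i))

  fresh-sound : ∀ (w : ℕ → C) k → (∀ d → 1 ≤ d → d ≤ 2 → d ≤ k → π (w 0) ≢ π (w d)) →
                T (fresh (applyUpTo (w ∘ suc) k) (w 0))
  fresh-sound w zero _ = tt
  fresh-sound w 1 d with π (w 0) ≟ π (w 1)
  ... | yes eq = d 1 (s≤s z≤n) (s≤s z≤n) (s≤s z≤n) eq
  ... | no  _  = tt
  fresh-sound w (suc (suc k)) d with π (w 0) ≟ π (w 1) | π (w 0) ≟ π (w 2)
  ... | yes eq | _      = d 1 (s≤s z≤n) (s≤s z≤n) (s≤s z≤n) eq
  ... | no _   | yes eq = d 2 (s≤s z≤n) (s≤s (s≤s z≤n)) (s≤s (s≤s z≤n)) eq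
  ... | no _   | no _   = tt

  ∈-factors : ∀ (w : ℕ → C) k →
              (∀ i d → 1 ≤ d → d ≤ 2 → i + d < k → π (w i) ≢ π (w (i + d))) →
              applyUpTo w k ∈ factors k
  ∈-factors w zero    _ = here refl
  ∈-factors w (suc k) d = ∈-concatMap⁺ _ (lose
    (∈-factors (w ∘ suc) k (λ i e 1≤e e≤2 lt → d (suc i) e 1≤e e≤2 (s<s lt)))
    (∈-map⁺ _ (∈-filter⁺ (T? ∘ fresh u) (complete (w 0))
      (fresh-sound w k (λ e 1≤e e≤2 e≤k → d 0 e 1≤e e≤2 (s≤s e≤k))))))
    where u = applyUpTo (w ∘ suc) k

  -- Positions up to M q lie in blocks with index at most M, and three blocks from there reach index
  -- M + 2 at most; this is the reason for the margin 3.
  source-factor : ∀ {w M k} → SourceUpTo (3 + M) (π ∘ w) → ∀ j → j ≤ M → k ≤ 3 →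
                  applyUpTo (λ t → w (j + t)) k ∈ factors k
  source-factor {w} {M} {k} src j j≤M k≤3 = ∈-factors _ k λ i d 1≤d d≤2 lt eq →
    source-distinct {x = π ∘ w} src (j + i) d 1≤d d≤2
      (begin-strict
        j + i + d   ≡⟨ +-assoc j i d ⟩
        j + (i + d) <⟨ +-monoʳ-< j lt ⟩
        j + k       ≤⟨ +-mono-≤ j≤M k≤3 ⟩
        M + 3       ≡⟨ +-comm M 3 ⟩
        3 + M       ∎)
      (trans eq (cong (π ∘ w) (sym (+-assoc j i d))))
    where open ≤-Reasoning

  module _ (uniform : T (all (λ x → length (h x) ≡ᵇ q) letters)) where

    length-h : ∀ x → length (h x) ≡ q
    length-h x = ≡ᵇ⇒≡ _ _ (all-lookup (λ x → length (h x) ≡ᵇ q) uniform (complete x))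

    h-letters : ∀ x → h x ≡ applyUpTo (h x ‼_) q
    h-letters x = trans (sym (applyUpTo-‼ (h x))) (cong (applyUpTo (h x ‼_)) (length-h x))

    concatMap-image : ∀ w k → concatMap h (applyUpTo w k) ≡ applyUpTo (image w) (k * q)
    concatMap-image w zero    = refl
    concatMap-image w (suc k) = begin
      h (w 0) ++ concatMap h (applyUpTo (w ∘ suc) k)
        ≡⟨ cong₂ _++_ (h-letters (w 0)) (concatMap-image (w ∘ suc) k) ⟩
      applyUpTo (h (w 0) ‼_) q ++ applyUpTo (image (w ∘ suc)) (k * q)
        ≡⟨ cong₂ _++_ (applyUpTo-cong q (λ i i<q → sym (image-block w 0 i i<q)))
             (applyUpTo-cong (k * q) (λ i _ →
               trans (sym (image-shift w 1 i)) (cong (λ z → image w (z + i)) (*-identityˡ q)))) ⟩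
      applyUpTo (image w) q ++ applyUpTo (λ i → image w (q + i)) (k * q)
        ≡⟨ applyUpTo-++ (image w) q (k * q) ⟨
      applyUpTo (image w) (q + k * q) ∎
      where open ≡-Reasoning

    separated-sound : ∀ i m {x y} → T (separated i m) → i + m ≤ q →
                      (∀ t → t < m → h x ‼ (i + t) ≡ h y ‼ (i + t)) → π x ≡ π y
    separated-sound i m {x} {y} sep i+m≤q eq with Equivalence.to (T-∨ {does (π x ≟ π y)})
      (all-lookup (λ y → does (π x ≟ π y) ∨ not (agree m (drop i (h x)) (drop i (h y))))
        (all-lookup (λ x → all (λ y → does (π x ≟ π y) ∨ not (agree m (drop i (h x)) (drop i (h y)))) letters)
          sep (complete x)) (complete y))
    ... | inj₁ same  = does-T (π x ≟ π y) same
    ... | inj₂ ¬agree = ⊥-elim (T-not ¬agree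
      (subst₂ (λ u v → T (agree m u v)) (sym (tail x)) (sym (tail y)) (agree-complete m≤ m≤ eq)))
      where
      m≤ : m ≤ q ∸ i
      m≤ = m+n≤o⇒m≤o∸n m (≤-trans (≤-reflexive (+-comm m i)) i+m≤q)
      tail : ∀ z → drop i (h z) ≡ applyUpTo (λ t → h z ‼ (i + t)) (q ∸ i)
      tail z = trans (cong (drop i) (trans (h-letters z)
        (cong (applyUpTo (h z ‼_)) (sym (m+[n∸m]≡n (≤-trans (m≤m+n i m) i+m≤q))))))
        (drop-applyUpTo (h z ‼_) i (q ∸ i))

  -- Repetitions in the image of a source

  module Preservation
    {N D κ P L E₁ E₂ k : ℕ} .{{_ : NonZero D}} (cert : Certificate N D κ P L E₁ E₂ k)
    (M : ℕ) (w : ℕ → C) (source : SourceUpTo (3 + M) (π ∘ w))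
    where

    open Certificate cert

    quotient≤ : ∀ s {t} → s ≤ t → t ≤ M * q → s / q ≤ M
    quotient≤ s s≤t t≤ = *-cancelʳ-≤ (s / q) M q (≤-trans (m/n*n≤m s q) (≤-trans s≤t t≤))

    -- A shift by whole blocks moves the start to `s % q`, at most q - 1. From there the window
    -- inequality fits the period and the shortest forbidden overlap into the image of `j` letters,
    -- and longer overlaps contain the shortest one.
    freeUpTo-sound : ∀ {ps j p s e} → j ≤ 3 → T (freeUpTo (threshold N D κ) ps j) → p ∈ ps →
                     q + (p + threshold N D κ p) ≤ suc (j * q) → s ≤ M * q →
                     threshold N D κ p ≤ e → ¬ Repeats (image w) s p e
    freeUpTo-sound {ps} {j} {p} {s} j≤3 free p∈ window s≤ thr≤e rep =
      repetitionFree-sound {s = s % q}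
        (subst (λ xs → T (repetitionFree (threshold N D κ) q ps xs)) (concatMap-image uniform (λ t → w (s / q + t)) j)
          (all-lookup (λ u → repetitionFree (threshold N D κ) q ps (concatMap h u)) free
            (source-factor {w} source (s / q) (quotient≤ s ≤-refl s≤) j≤3)))
        p∈ (m%n<n s q) (s≤s z≤n)
        (≤-trans (≤-reflexive (+-assoc (s % q) p _))
          (s≤s⁻¹ (≤-trans (+-monoˡ-≤ (p + threshold N D κ p) (m%n<n s q)) window)))
        (λ i i< → trans (sym (image-split w s i)) (trans (rep i (≤-trans i< thr≤e))
          (trans (cong (image w) (+-assoc s p i))
            (trans (image-split w s (p + i)) (cong (image (λ t → w (s / q + t))) (sym (+-assoc (s % q) p i)))))))

    ∈-windows : ∀ s → s ≤ M * q →
                (s % q , applyUpTo (λ i → image (λ t → w (s / q + t)) (s % q + i)) (2 * q ∸ s % q)) ∈ windows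
    ∈-windows s s≤ = ∈-concatMap⁺ _ (lose
      (source-factor {w} source (s / q) (quotient≤ s ≤-refl s≤) (s≤s (s≤s z≤n)))
      (subst (λ xs → (s % q , applyUpTo (λ i → image (λ t → w (s / q + t)) (s % q + i)) (2 * q ∸ s % q)) ∈ offsets q 0 xs) (sym (concatMap-image uniform (λ t → w (s / q + t)) 2))
        (∈-offsets (image (λ t → w (s / q + t))) 0 (s % q) (m%n<n s q) (m≤m+n q _))))

    window-length : ∀ s → L ≤ 2 * q ∸ s % q
    window-length s = m+n≤o⇒m≤o∸n L (begin
      L + s % q       ≤⟨ +-monoˡ-≤ (s % q) L≤1+q ⟩
      suc q + s % q   ≡⟨ +-suc q (s % q) ⟨
      q + suc (s % q) ≤⟨ +-monoʳ-≤ q (m%n<n s q) ⟩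
      q + q           ≡⟨ cong (q +_) (+-identityʳ q) ⟨
      2 * q           ∎)
      where open ≤-Reasoning

    -- The first L letters of the overlap occur at offsets `s % q` and `(s + p) % q` of two-letter
    -- images, and `synchronizing` allows such a factor only one offset.
    residues-agree : ∀ {s p e} → s + p ≤ M * q → L ≤ e → Repeats (image w) s p e → s % q ≡ (s + p) % q
    residues-agree {s} {p} s+p≤ L≤e rep =
      prefixDetermined-sound L synchronizing (window-length s) (window-length (s + p))
        (λ t t<L → trans (sym (image-split w s t))
          (trans (rep t (≤-trans t<L L≤e)) (image-split w (s + p) t)))
        (∈-windows s (≤-trans (m≤m+n s p) s+p≤)) (∈-windows (s + p) s+p≤)

    period-multiple : ∀ s p → s % q ≡ (s + p) % q → p ≡ ((s + p) / q ∸ s / q) * q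
    period-multiple s p eq = begin
      p                               ≡⟨ m+n∸m≡n s p ⟨
      (s + p) ∸ s                     ≡⟨ cong₂ _∸_ (split (s + p)) (split s) ⟩
      (j′ * q + (s + p) % q) ∸ (j * q + s % q)
                                      ≡⟨ cong (λ z → (j′ * q + z) ∸ (j * q + s % q)) (sym eq) ⟩
      (j′ * q + s % q) ∸ (j * q + s % q)
                                      ≡⟨ cong₂ _∸_ (+-comm (j′ * q) (s % q)) (+-comm (j * q) (s % q)) ⟩
      (s % q + j′ * q) ∸ (s % q + j * q)
                                      ≡⟨ [m+n]∸[m+o]≡n∸o (s % q) (j′ * q) (j * q) ⟩
      j′ * q ∸ j * q                  ≡⟨ *-distribʳ-∸ q j′ j ⟨
      (j′ ∸ j) * q                    ∎
      where
      open ≡-Reasoning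
      j  = s / q
      j′ = (s + p) / q

    -- The overlap of a repetition of period k q consists of at most E₂ + E₁
    -- letters at its ends and of full blocks, which repeat in the source.
    module Aligned (s k e : ℕ) (2≤k : 2 ≤ k) (bound : s + k * q + e ≤ M * q)
                   (rep : Repeats (image w) s (k * q) e) where

      j = s / q
      i₀ = s % q

      Matched : ℕ → Set
      Matched t = π (w t) ≡ π (w (t + k))

      letter : ∀ t i → i < q → s ≤ t * q + i → t * q + i < s + e → h (w t) ‼ i ≡ h (w (t + k)) ‼ i
      letter t i i<q s≤ <s+e = begin
        h (w t) ‼ i                     ≡⟨ image-block w t i i<q ⟨
        image w (t * q + i)             ≡⟨ cong (image w) (m+[n∸m]≡n s≤) ⟨
        image w (s + d)                 ≡⟨ rep d (+-cancelˡ-< s d e (≤-<-trans (≤-reflexive (m+[n∸m]≡n s≤)) <s+e)) ⟩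
        image w (s + k * q + d)         ≡⟨ cong (image w) shift ⟩
        image w ((t + k) * q + i)       ≡⟨ image-block w (t + k) i i<q ⟩
        h (w (t + k)) ‼ i               ∎
        where
        open ≡-Reasoning
        d = t * q + i ∸ s
        shift : s + k * q + d ≡ (t + k) * q + i
        shift = begin
          s + k * q + d       ≡⟨ xy∙z≈xz∙y s (k * q) d ⟩
          s + d + k * q       ≡⟨ cong (_+ k * q) (m+[n∸m]≡n s≤) ⟩
          t * q + i + k * q   ≡⟨ rearrange₁ t k q i ⟩
          (t + k) * q + i     ∎
          where
          rearrange₁ : ∀ t k q i → t * q + i + k * q ≡ (t + k) * q + i
          rearrange₁ = solve-∀

      Goal : Set
      Goal = e * D + κ ≤ N * (k * q)

      -- A run of m matches at distance k is a repetition of the source, so 2m + 1 ≤ k. With this,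
      -- the doubled claim for k = 2 is `slack`; raising k by one adds D q on the left and 2 N q on
      -- the right, which `D≤2N` covers. Adding 2 D q to both sides avoids subtraction.
      finish : ∀ j₀ m → (∀ t → t < m → Matched (j₀ + t)) → j₀ + k + m ≤ 3 + M →
               e ≤ m * q + (E₁ + E₂) → Goal
      finish j₀ m matched le e≤ = *-cancelˡ-≤ 2 (+-cancelʳ-≤ (2 * (D * q)) _ _ (begin
        2 * (e * D + κ) + 2 * (D * q)
          ≤⟨ +-monoˡ-≤ (2 * (D * q)) (*-monoʳ-≤ 2 (+-monoˡ-≤ κ (*-monoˡ-≤ D e≤))) ⟩
        2 * ((m * q + (E₁ + E₂)) * D + κ) + 2 * (D * q)
          ≡⟨ rearrange₁ m q (E₁ + E₂) D κ ⟩
        (m * 2 + 1) * (q * D) + (2 * ((E₁ + E₂) * D + κ) + D * q)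
          ≤⟨ +-mono-≤ (*-monoˡ-≤ (q * D) (≤-trans source-bound (≤-reflexive (*-identityˡ k)))) slack ⟩
        k * (q * D) + 4 * N * q
          ≡⟨ cong (λ z → z * (q * D) + 4 * N * q) (m+[n∸m]≡n 2≤k) ⟨
        (2 + k′) * (q * D) + 4 * N * q
          ≡⟨ rearrange₂ k′ q D N ⟩
        k′ * q * D + (2 * (D * q) + 4 * N * q)
          ≤⟨ +-monoˡ-≤ (2 * (D * q) + 4 * N * q) (*-monoʳ-≤ (k′ * q) D≤2N) ⟩
        k′ * q * (2 * N) + (2 * (D * q) + 4 * N * q)
          ≡⟨ rearrange₃ k′ q D N ⟩
        2 * (N * ((2 + k′) * q)) + 2 * (D * q)
          ≡⟨ cong (λ z → 2 * (N * (z * q)) + 2 * (D * q)) (m+[n∸m]≡n 2≤k) ⟩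
        2 * (N * (k * q)) + 2 * (D * q) ∎))
        where
        open ≤-Reasoning
        k′ = k ∸ 2
        source-bound : m * 2 + 1 ≤ 1 * k
        source-bound = source j₀ k m (≤-trans (s≤s z≤n) 2≤k) le λ t t<m →
          trans (matched t t<m) (cong (π ∘ w) (xy∙z≈xz∙y j₀ t k))
        rearrange₁ : ∀ m q E D κ → 2 * ((m * q + E) * D + κ) + 2 * (D * q) ≡
                               (m * 2 + 1) * (q * D) + (2 * (E * D + κ) + D * q)
        rearrange₁ = solve-∀
        rearrange₂ : ∀ k q D N → (2 + k) * (q * D) + 4 * N * q ≡ k * q * D + (2 * (D * q) + 4 * N * q)
        rearrange₂ = solve-∀
        rearrange₃ : ∀ k q D N → k * q * (2 * N) + (2 * (D * q) + 4 * N * q) ≡ 2 * (N * ((2 + k) * q)) + 2 * (D * q)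
        rearrange₃ = solve-∀

      -- The overlap lies inside one block, so e < q, and a period of at least 2q suffices without
      -- recourse to the source.
      short : i₀ + e < q → Goal
      short lt = begin
        e * D + κ       ≤⟨ +-monoʳ-≤ (e * D) κ≤D ⟩
        e * D + D       ≡⟨ +-comm (e * D) D ⟩
        suc e * D       ≤⟨ *-monoˡ-≤ D (≤-<-trans (m≤n+m e i₀) lt) ⟩
        q * D           ≤⟨ *-monoʳ-≤ q D≤2N ⟩
        q * (2 * N)     ≡⟨ rearrange₁ q N ⟩
        N * (2 * q)     ≤⟨ *-monoʳ-≤ N (*-monoˡ-≤ q 2≤k) ⟩
        N * (k * q)     ∎
        where
        open ≤-Reasoning
        rearrange₁ : ∀ q N → q * (2 * N) ≡ N * (2 * q)
        rearrange₁ = solve-∀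

      module Long (ge : q ≤ i₀ + e) where

        -- The overlap consists of the last f letters of block `j`, m whole blocks, and the first l
        -- letters of block `suc j + m`.
        f = q ∸ i₀
        rest = e ∸ f
        m = rest / q
        l = rest % q

        i₀+f≡q : i₀ + f ≡ q
        i₀+f≡q = m+[n∸m]≡n (<⇒≤ (m%n<n s q))

        e≡ : e ≡ f + (m * q + l)
        e≡ = trans (sym (m+[n∸m]≡n (m≤n+o⇒m∸n≤o q i₀ ge))) (cong (f +_) (split rest))

        end : s + e ≡ (suc j + m) * q + l
        end = begin
          s + e                             ≡⟨ cong₂ _+_ (split s) e≡ ⟩
          j * q + i₀ + (f + (m * q + l))    ≡⟨ rearrange₁ (j * q) i₀ f (m * q) l ⟩
          (i₀ + f) + j * q + m * q + l      ≡⟨ cong (λ z → z + j * q + m * q + l) i₀+f≡q ⟩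
          q + j * q + m * q + l             ≡⟨ cong (_+ l) (sym (*-distribʳ-+ q (suc j) m)) ⟩
          (suc j + m) * q + l               ∎
          where
          open ≡-Reasoning
          rearrange₁ : ∀ a b c d e → a + b + (c + (d + e)) ≡ b + c + a + d + e
          rearrange₁ = solve-∀

        s<next : s < suc j * q
        s<next = begin-strict
          s          ≡⟨ split s ⟩
          j * q + i₀ <⟨ +-monoʳ-< (j * q) (m%n<n s q) ⟩
          j * q + q  ≡⟨ +-comm (j * q) q ⟩
          suc j * q  ∎
          where open ≤-Reasoning

        next≤end : ∀ t → t ≤ m → (suc j + t) * q ≤ s + e
        next≤end t t≤m = ≤-trans (*-monoˡ-≤ q (+-monoʳ-≤ (suc j) t≤m))
          (≤-trans (m≤m+n _ l) (≤-reflexive (sym end)))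

        s≤next : ∀ t i → s ≤ (suc j + t) * q + i
        s≤next t i = ≤-trans (<⇒≤ s<next) (≤-trans (*-monoˡ-≤ q (m≤m+n (suc j) t)) (m≤m+n _ i))

        -- Images of letters that differ under `π` share at most E₂ final letters, so a longer piece
        -- of block `j` forces a match. For `last`, prefixes play the same role.
        first : f ≤ E₂ ⊎ Matched j
        first with suc E₂ ≤? f
        ... | no  E₂≮f = inj₁ (s≤s⁻¹ (≰⇒> E₂≮f))
        ... | yes E₂<f = inj₂ (separated-sound uniform (q ∸ suc E₂) (suc E₂) suffixes
                (≤-reflexive (m∸n+n≡m E₂<q)) λ t t≤E₂ →
                let i<q = ≤-trans (+-monoʳ-< (q ∸ suc E₂) t≤E₂) (≤-reflexive (m∸n+n≡m E₂<q)) in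
                letter j _ i<q
                  (≤-trans (≤-reflexive (split s)) (+-monoʳ-≤ (j * q) (≤-trans i₀≤ (m≤m+n _ t))))
                  (≤-trans (+-monoʳ-< (j * q) i<q)
                    (≤-trans (≤-reflexive (+-comm (j * q) q))
                      (≤-trans (≤-reflexive (cong (_* q) (sym (+-identityʳ (suc j))))) (next≤end 0 z≤n)))))
          where
          i₀≤ : i₀ ≤ q ∸ suc E₂
          i₀≤ = m+n≤o⇒m≤o∸n i₀ (≤-trans (+-monoʳ-≤ i₀ E₂<f) (≤-reflexive i₀+f≡q))

        middle : ∀ t → t < m → Matched (suc j + t)
        middle t t<m = separated-sound uniform 0 (suc E₁) prefixes E₁<q λ i i≤E₁ →
          let i<q = ≤-trans i≤E₁ E₁<q in
          letter (suc j + t) i i<q (s≤next t i)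
            (≤-trans (+-monoʳ-< ((suc j + t) * q) i<q)
              (≤-trans (≤-reflexive (trans (+-comm _ q) (cong (_* q) (sym (+-suc (suc j) t)))))
                (next≤end (suc t) t<m)))

        last : l ≤ E₁ ⊎ Matched (suc j + m)
        last with suc E₁ ≤? l
        ... | no  E₁≮l = inj₁ (s≤s⁻¹ (≰⇒> E₁≮l))
        ... | yes E₁<l = inj₂ (separated-sound uniform 0 (suc E₁) prefixes E₁<q λ i i≤E₁ →
                letter (suc j + m) i (≤-trans i≤E₁ E₁<q) (s≤next m i)
                  (≤-trans (+-monoʳ-< ((suc j + m) * q) (≤-trans i≤E₁ E₁<l)) (≤-reflexive (sym end))))

        prepend : ∀ {c} → Matched j → (∀ t → t < c → Matched (suc j + t)) → ∀ t → t < suc c → Matched (j + t)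
        prepend mj ms zero    _   = subst Matched (sym (+-identityʳ j)) mj
        prepend mj ms (suc t) t<c = subst Matched (sym (+-suc j t)) (ms t (s<s⁻¹ t<c))

        append : Matched (suc j + m) → ∀ t → t < suc m → Matched (suc j + t)
        append mm t t<1+m with m≤n⇒m<n∨m≡n (s≤s⁻¹ t<1+m)
        ... | inj₁ t<m  = middle t t<m
        ... | inj₂ refl = mm

        -- Keeps the run of matches and its copy at distance k within the first 3 + M source
        -- letters, even if the incomplete last block counts as matched.
        j+m+k≤M : suc j + m + k ≤ suc M
        j+m+k≤M = *-cancelʳ-≤ _ _ q (begin
          (suc j + m + k) * q          ≡⟨ *-distribʳ-+ q (suc j + m) k ⟩
          (suc j + m) * q + k * q      ≤⟨ +-monoˡ-≤ (k * q) (next≤end m ≤-refl) ⟩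
          s + e + k * q                ≡⟨ xy∙z≈xz∙y s e (k * q) ⟩
          s + k * q + e                ≤⟨ bound ⟩
          M * q                        ≤⟨ m≤n+m (M * q) q ⟩
          suc M * q                    ∎)
          where
          open ≤-Reasoning

        f≤q : f ≤ q
        f≤q = m∸n≤m q i₀

        l≤q : l ≤ q
        l≤q = <⇒≤ (m%n<n rest q)

        goal : Goal
        -- A matched end joins the run as a whole block and accounts for at most q letters, an
        -- unmatched one for at most E₂ or E₁. So a run of m′ matches always comes with e ≤ m′ q +
        -- (E₁ + E₂).
        goal with first | last
        ... | inj₁ f≤ | inj₁ l≤ = finish (suc j) m middle
                (≤-trans (≤-reflexive (xy∙z≈xz∙y (suc j) k m)) (≤-trans j+m+k≤M (m≤n+m _ 2)))
                (≤-trans (≤-reflexive e≡) (≤-trans (+-mono-≤ f≤ (+-monoʳ-≤ (m * q) l≤))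
                  (≤-reflexive (rearrange₂ E₂ (m * q) E₁))))
          where
          rearrange₂ : ∀ x y z → x + (y + z) ≡ y + (z + x)
          rearrange₂ = solve-∀
        ... | inj₁ f≤ | inj₂ ml = finish (suc j) (suc m) (append ml)
                (≤-trans (≤-reflexive (rearrange₁ j k m)) (≤-trans (s≤s j+m+k≤M) (m≤n+m _ 1)))
                (≤-trans (≤-reflexive e≡) (≤-trans (+-mono-≤ f≤ (+-monoʳ-≤ (m * q) l≤q))
                  (≤-trans (≤-reflexive (rearrange₂ E₂ (m * q) q)) (+-monoʳ-≤ (suc m * q) (m≤n+m E₂ E₁)))))
          where
          rearrange₁ : ∀ j k m → suc j + k + suc m ≡ suc (suc j + m + k)
          rearrange₁ = solve-∀
          rearrange₂ : ∀ x y z → x + (y + z) ≡ z + y + x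
          rearrange₂ = solve-∀
        ... | inj₂ mf | inj₁ l≤ = finish j (suc m) (prepend mf middle)
                (≤-trans (≤-reflexive (rearrange₁ j k m)) (≤-trans j+m+k≤M (m≤n+m _ 2)))
                (≤-trans (≤-reflexive e≡) (≤-trans (+-mono-≤ f≤q (+-monoʳ-≤ (m * q) l≤))
                  (≤-trans (≤-reflexive (sym (+-assoc q (m * q) E₁))) (+-monoʳ-≤ (suc m * q) (m≤m+n E₁ E₂)))))
          where
          rearrange₁ : ∀ j k m → j + k + suc m ≡ suc j + m + k
          rearrange₁ = solve-∀
        ... | inj₂ mf | inj₂ ml = finish j (2 + m) (prepend mf (append ml))
                (≤-trans (≤-reflexive (rearrange₁ j k m)) (≤-trans (s≤s j+m+k≤M) (m≤n+m _ 1)))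
                (≤-trans (≤-reflexive e≡) (≤-trans (+-mono-≤ f≤q (+-monoʳ-≤ (m * q) l≤q))
                  (≤-trans (≤-reflexive (rearrange₂ q (m * q))) (m≤m+n _ (E₁ + E₂)))))
          where
          rearrange₁ : ∀ j k m → j + k + (2 + m) ≡ suc (suc j + m + k)
          rearrange₁ = solve-∀
          rearrange₂ : ∀ x y → x + (y + x) ≡ x + (x + y)
          rearrange₂ = solve-∀

      goal : Goal
      goal with i₀ + e <? q
      ... | yes lt = short lt
      ... | no ¬lt = Long.goal (≮⇒≥ ¬lt)

    threshold≤ : ∀ {p e} → 1 ≤ p → N * p < e * D + κ → threshold N D κ p ≤ e
    threshold≤ {p} {e} 1≤p lt = m<n*o⇒m/o<n (+-cancelʳ-< κ (N * p ∸ κ) (e * D)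
      (≤-<-trans (≤-reflexive (m∸n+n≡m (≤-trans κ≤N (m≤m*n N p {{>-nonZero 1≤p}})))) lt))

    -- If e < L, then `P-large` gives (e + 1) D + κ ≤ L D + κ ≤ N (P + 1) + D ≤ N p + D, so the
    -- bound is not violated.
    L≤ : ∀ {p e} → P < p → N * p < e * D + κ → L ≤ e
    L≤ {p} {e} P<p lt = ≮⇒≥ λ e<L → <⇒≱ lt (+-cancelʳ-≤ D _ _ (begin
      e * D + κ + D       ≡⟨ rearrange₁ (e * D) κ D ⟩
      suc e * D + κ       ≤⟨ +-monoˡ-≤ κ (*-monoˡ-≤ D e<L) ⟩
      L * D + κ           ≤⟨ P-large ⟩
      N * suc P + D       ≤⟨ +-monoˡ-≤ D (*-monoʳ-≤ N P<p) ⟩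
      N * p + D           ∎))
      where
      open ≤-Reasoning
      rearrange₁ : ∀ x y z → x + y + z ≡ z + x + y
      rearrange₁ = solve-∀

    image-bounded : Bounded N D κ (M * q) (image w)
    image-bounded s p e 1≤p bound rep with e * D + κ ≤? N * p
    ... | yes ok = ok
    ... | no ¬ok with p ≤? P
    ...   | yes p≤P = ⊥-elim (freeUpTo-sound k≤3 shortPeriods p∈
              (≤-trans (+-monoʳ-≤ q (+-mono-≤ p≤P (threshold-mono N D κ p≤P))) k-window)
              (≤-trans (≤-trans (m≤m+n s p) (m≤m+n (s + p) e)) bound) (threshold≤ 1≤p (≰⇒> ¬ok)) rep)
      where
      p∈ : p ∈ applyUpTo suc P
      p∈ = subst (_∈ applyUpTo suc P) (m+[n∸m]≡n 1≤p)
             (∈-applyUpTo⁺ suc (≤-trans (≤-reflexive (m+[n∸m]≡n 1≤p)) p≤P))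
    ...   | no p≰P = case (((s + p) / q) ∸ s / q) (period-multiple s p
              (residues-agree (≤-trans (m≤m+n (s + p) e) bound) (L≤ (≰⇒> p≰P) (≰⇒> ¬ok)) rep))
      where
      -- Period 0 contradicts `1≤p`, and period q is excluded by the check on images of three
      -- letters; from 2q on the source supplies the bound.
      case : ∀ k → p ≡ k * q → e * D + κ ≤ N * p
      case zero refl = contradiction 1≤p λ ()
      case 1 p≡q = ⊥-elim (freeUpTo-sound {ps = q ∷ []} ≤-refl blockPeriod (here (trans p≡q (*-identityˡ q)))
        (subst (λ z → q + (z + threshold N D κ z) ≤ suc (3 * q)) (sym (trans p≡q (*-identityˡ q))) 3-window)
        (≤-trans (≤-trans (m≤m+n s p) (m≤m+n (s + p) e)) bound) (threshold≤ 1≤p (≰⇒> ¬ok)) rep)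
      case (suc (suc k)) refl = Aligned.goal s (2 + k) e (s≤s (s≤s z≤n)) bound rep

  -- Letter patterns and injectivity

  avoiding : LetterPattern → Bool
  avoiding p = all (λ u → not (contains p q (concatMap h u))) (factors 2)

  -- A factor of length at most q + 1 that starts in one block ends no later than the next, so
  -- images of two letters show every occurrence.
  avoiding-sound : ∀ {p w M} → T (all (λ x → length (h x) ≡ᵇ q) letters) → T (avoiding p) →
                   length p ≤ suc q → SourceUpTo (3 + M) (π ∘ w) →
                   ∀ s σ → s ≤ M * q → (∀ {v v′} → v ∈ p → v′ ∈ p → σ v ≡ σ v′ → v ≡ v′) →
                   applyUpTo (λ i → image w (s + i)) (length p) ≢ map σ p
  avoiding-sound {p} {w} {M} uniform avoid p≤ source s σ s≤ inj eq =
    T-not (all-lookup (λ u → not (contains p q (concatMap h u))) avoid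
            (source-factor {w} source j (*-cancelʳ-≤ j M q (≤-trans (m/n*n≤m s q) s≤)) (s≤s (s≤s z≤n))))
      (subst (T ∘ contains p q) (sym (concatMap-image uniform wⱼ 2))
        (contains-complete p i₀ (m%n<n s q) (m≤m+n q (1 * q))
          (subst (T ∘ startsWith p) (sym starts) (startsWith-complete σ p _ inj))))
    where
    j  = s / q
    i₀ = s % q
    wⱼ : ℕ → C
    wⱼ t = w (j + t)
    l  = length p
    l≤ : i₀ + l ≤ 2 * q
    l≤ = begin
      i₀ + l          ≤⟨ +-monoʳ-≤ i₀ p≤ ⟩
      i₀ + suc q      ≡⟨ +-suc i₀ q ⟩
      suc i₀ + q      ≤⟨ +-monoˡ-≤ q (m%n<n s q) ⟩
      q + q           ≡⟨ cong (q +_) (+-identityʳ q) ⟨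
      2 * q           ∎
      where open ≤-Reasoning
    starts : applyUpTo (λ i → image wⱼ (i₀ + i)) (2 * q ∸ i₀) ≡
             map σ p ++ applyUpTo (λ i → image wⱼ (i₀ + (l + i))) (2 * q ∸ i₀ ∸ l)
    starts = begin
      applyUpTo f (2 * q ∸ i₀)
        ≡⟨ cong (applyUpTo f) (m+[n∸m]≡n (m+n≤o⇒m≤o∸n l (≤-trans (≤-reflexive (+-comm l i₀)) l≤))) ⟨
      applyUpTo f (l + (2 * q ∸ i₀ ∸ l))
        ≡⟨ applyUpTo-++ f l (2 * q ∸ i₀ ∸ l) ⟩
      applyUpTo f l ++ rest
        ≡⟨ cong (_++ rest) (trans (applyUpTo-cong l (λ i _ → sym (image-split w s i))) eq) ⟩
      map σ p ++ rest ∎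
      where
      open ≡-Reasoning
      f = λ i → image wⱼ (i₀ + i)
      rest = applyUpTo (λ i → f (l + i)) (2 * q ∸ i₀ ∸ l)

  module _ (_≟ᶜ_ : DecidableEquality C) where

    injective : Bool
    injective = all (λ x → all (λ y → does (x ≟ᶜ y) ∨ not (agree q (h x) (h y))) letters) letters

    -- In contrast to `separated`, whole images are compared and letters are not taken modulo `π`,
    -- so the chosen images can be read off the stream.
    image-injective : ∀ {w w′} → T (all (λ x → length (h x) ≡ᵇ q) letters) → T injective → ∀ n →
                      (∀ i → i < n * q → image w i ≡ image w′ i) → ∀ j → j < n → w j ≡ w′ j
    image-injective {w} {w′} uniform inj n eq j j<n
      with Equivalence.to (T-∨ {does (w j ≟ᶜ w′ j)})
        (all-lookup (λ y → does (w j ≟ᶜ y) ∨ not (agree q (h (w j)) (h y)))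
          (all-lookup (λ x → all (λ y → does (x ≟ᶜ y) ∨ not (agree q (h x) (h y))) letters)
            inj (complete (w j))) (complete (w′ j)))
    ... | inj₁ same   = does-T (w j ≟ᶜ w′ j) same
    ... | inj₂ differ = ⊥-elim (T-not differ
      (subst₂ (λ u v → T (agree q u v)) (sym (h-letters uniform (w j))) (sym (h-letters uniform (w′ j)))
        (agree-complete {f = h (w j) ‼_} ≤-refl ≤-refl λ i i<q →
          trans (sym (image-block w j i i<q))
            (trans (eq (j * q + i) (≤-trans (+-monoʳ-< (j * q) i<q)
                     (≤-trans (≤-reflexive (+-comm (j * q) q)) (*-monoˡ-≤ q j<n))))
              (image-block w′ j i i<q)))))

-- From streams to words

prefix-applyUpTo : ∀ {z : ℕ → A} {v} n → Prefix _≡_ v (applyUpTo z n) →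
                   ∃[ l ] l ≤ n × v ≡ applyUpTo z l
prefix-applyUpTo zero    []         = 0 , z≤n , refl
prefix-applyUpTo (suc n) []         = 0 , z≤n , refl
prefix-applyUpTo (suc n) (refl ∷ p) with l , l≤n , refl ← prefix-applyUpTo n p = suc l , s≤s l≤n , refl

factor-applyUpTo : ∀ {z : ℕ → A} {v} n → v IsFactorOf applyUpTo z n →
                   ∃[ s ] ∃[ l ] s + l ≤ n × v ≡ applyUpTo (λ i → z (s + i)) l
factor-applyUpTo zero    (here p)  with l , l≤n , eq ← prefix-applyUpTo 0 p = 0 , l , l≤n , eq
factor-applyUpTo (suc n) (here p)  with l , l≤n , eq ← prefix-applyUpTo (suc n) p = 0 , l , l≤n , eq
factor-applyUpTo (suc n) (there p) with s , l , le , eq ← factor-applyUpTo n p = suc s , l , s≤s le , eq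

/-cancel-< : ∀ k l m n → (ℤ.+ k) ℚ./ suc l ℚ.< (ℤ.+ m) ℚ./ suc n → k * suc n < m * suc l
/-cancel-< k l m n lt with ℚᵘ.<-respˡ-≃ (toℚᵘ-fromℚᵘ (mkℚᵘ (ℤ.+ k) l)) (ℚᵘ.<-respʳ-≃ (toℚᵘ-fromℚᵘ (mkℚᵘ (ℤ.+ m) n)) (ℚ.toℚᵘ-mono-< lt))
... | *<* lt′ = ℤ.drop‿+<+ (subst₂ ℤ._<_ (sym (ℤ.pos-* k (suc n))) (sym (ℤ.pos-* m (suc l))) lt′)

-- A power of u of length l > |u| is a repetition with period |u| and overlap l - |u|. The bound
-- then reads l D ≤ (N + D) |u|, which also holds for l ≤ |u| and contradicts an exponent above 1 +
-- N/D.
bounded⇒free : ∀ {N D-1 n} {z : ℕ → A} → Bounded N (suc D-1) 0 n z →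
               (((ℤ.+ (N + suc D-1)) ℚ./ suc D-1) ⁺-Free) (applyUpTo z n)
bounded⇒free {N = N} {D-1} {n} {z} bnd v u@(_ ∷ _) ρ factor ρ>β (_ , periodic , refl)
  with s , l , le , refl ← factor-applyUpTo n factor =
  <⇒≱ (/-cancel-< (N + D) D-1 (length (applyUpTo zₛ l)) (List⁺.length u ∸ 1) ρ>β)
    (≤-trans (≤-reflexive (cong (_* D) (length-applyUpTo zₛ l))) main)
  where
  open ≤-Reasoning
  D = suc D-1
  p = List⁺.length u
  zₛ : ℕ → _
  zₛ i = z (s + i)
  letter : ∀ i → i < l → zₛ i ≡ lookup (List⁺.toList u) (i mod p)
  letter i i<l = trans (sym (trans (lookup-applyUpTo zₛ l j) (cong zₛ toℕ-j)))
    (trans (periodic j) (cong (λ k → lookup (List⁺.toList u) (k mod p)) toℕ-j))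
    where
    i<′ : i < length (applyUpTo zₛ l)
    i<′ = ≤-trans i<l (≤-reflexive (sym (length-applyUpTo zₛ l)))
    j = fromℕ< i<′
    toℕ-j : toℕ j ≡ i
    toℕ-j = toℕ-fromℕ< i<′
  main : l * D ≤ (N + D) * p
  main with ≤-total l p
  ... | inj₁ l≤p = begin
    l * D          ≤⟨ *-monoˡ-≤ D l≤p ⟩
    p * D          ≤⟨ m≤n+m (p * D) (p * N) ⟩
    p * N + p * D  ≡⟨ *-distribˡ-+ p N D ⟨
    p * (N + D)    ≡⟨ *-comm p (N + D) ⟩
    (N + D) * p    ∎
  ... | inj₂ p≤l = begin
    l * D                       ≡⟨ cong (_* D) (m∸n+n≡m p≤l) ⟨
    (e + p) * D                 ≡⟨ *-distribʳ-+ D e p ⟩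
    e * D + p * D               ≡⟨ cong₂ _+_ (+-identityʳ (e * D)) (*-comm D p) ⟨
    e * D + 0 + D * p           ≤⟨ +-monoˡ-≤ (D * p) (bnd s p e (s≤s z≤n)
                                     (≤-trans (≤-reflexive (trans (+-assoc s p e) (cong (s +_) (m+[n∸m]≡n p≤l)))) le)
                                     repeat) ⟩
    N * p + D * p               ≡⟨ *-distribʳ-+ p N D ⟨
    (N + D) * p                 ∎
    where
    e = l ∸ p
    repeat : Repeats z s p e
    repeat i i<e = trans (letter i (≤-trans i<e (m∸n≤m l p)))
      (trans (cong (lookup (List⁺.toList u)) (fromℕ<-cong _ _ (sym (trans (cong (_% p) (+-comm p i)) ([m+n]%n≡m%n i p))) _ _))
        (trans (sym (letter (p + i) (≤-trans (+-monoʳ-< p i<e) (≤-reflexive (m+[n∸m]≡n p≤l)))))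
          (cong z (sym (+-assoc s p i)))))

-- Growth of a power of two

ι : ℕ → ℚ
ι m = (ℤ.+ m) ℚ./ 1

toℚᵘ-ι : ∀ m → ℚ.toℚᵘ (ι m) ℚᵘ.≃ mkℚᵘ (ℤ.+ m) 0
toℚᵘ-ι m = toℚᵘ-fromℚᵘ (mkℚᵘ (ℤ.+ m) 0)

ι-mono-≤ : ∀ {m n} → m ≤ n → ι m ℚ.≤ ι n
ι-mono-≤ {m} {n} m≤n = ℚ.toℚᵘ-cancel-≤
  (ℚᵘ.≤-respˡ-≃ (ℚᵘ.≃-sym (toℚᵘ-ι m)) (ℚᵘ.≤-respʳ-≃ (ℚᵘ.≃-sym (toℚᵘ-ι n))
    (*≤* (ℤ.*-monoʳ-≤-nonNeg (ℤ.+ 1) (ℤ.+≤+ m≤n)))))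

/-*-ι : ∀ k l-1 m n → k * m ≡ n * suc l-1 → ((ℤ.+ k) ℚ./ suc l-1) ℚ.* ι m ≡ ι n
/-*-ι k l-1 m n eq = ℚ.toℚᵘ-injective (begin
  ℚ.toℚᵘ (((ℤ.+ k) ℚ./ suc l-1) ℚ.* ι m)
    ≈⟨ ℚ.toℚᵘ-homo-* ((ℤ.+ k) ℚ./ suc l-1) (ι m) ⟩
  ℚ.toℚᵘ ((ℤ.+ k) ℚ./ suc l-1) ℚᵘ.* ℚ.toℚᵘ (ι m)
    ≈⟨ ℚᵘ.*-cong (toℚᵘ-fromℚᵘ (mkℚᵘ (ℤ.+ k) l-1)) (toℚᵘ-ι m) ⟩
  mkℚᵘ (ℤ.+ k) l-1 ℚᵘ.* mkℚᵘ (ℤ.+ m) 0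
    ≈⟨ *≡* (trans (ℤ.*-identityʳ _) (trans (sym (ℤ.pos-* k m)) (trans (cong ℤ.+_ (trans eq (cong (n *_) (sym (*-identityʳ (suc l-1)))))) (ℤ.pos-* n (suc l-1 * 1))))) ⟩
  mkℚᵘ (ℤ.+ n) 0
    ≈⟨ toℚᵘ-ι n ⟨
  ℚ.toℚᵘ (ι n) ∎)
  where open import Relation.Binary.Reasoning.Setoid ℚᵘ.≃-setoid

ι-* : ∀ m n → ι m ℚ.* ι n ≡ ι (m * n)
ι-* m n = /-*-ι m 0 n (m * n) (sym (*-identityʳ (m * n)))

infixr 8 _^ℚ_
_^ℚ_ : ℚ → ℕ → ℚ
_^ℚ_ = pow ℚ.+-*-rawSemiring

/-^-ι : ∀ k l-1 n → ((ℤ.+ k) ℚ./ suc l-1) ^ℚ n ℚ.* ι (suc l-1 ^ n) ≡ ι (k ^ n)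
/-^-ι k l-1 zero    = refl
/-^-ι k l-1 (suc n) = begin
  (x ℚ.* x ^ℚ n) ℚ.* ι (l * l ^ n)         ≡⟨ cong ((x ℚ.* x ^ℚ n) ℚ.*_) (ι-* l (l ^ n)) ⟨
  (x ℚ.* x ^ℚ n) ℚ.* (ι l ℚ.* ι (l ^ n))   ≡⟨ interchange x (x ^ℚ n) (ι l) (ι (l ^ n)) ⟩
  (x ℚ.* ι l) ℚ.* (x ^ℚ n ℚ.* ι (l ^ n))   ≡⟨ cong₂ ℚ._*_ (/-*-ι k l-1 l k refl) (/-^-ι k l-1 n) ⟩
  ι k ℚ.* ι (k ^ n)                        ≡⟨ ι-* k (k ^ n) ⟩
  ι (k * k ^ n)                            ∎
  where
  open ≡-Reasoning
  open import Algebra.Properties.CommutativeSemigroup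
    (CommutativeMonoid.commutativeSemigroup ℚ.*-1-commutativeMonoid) using (interchange)
  l = suc l-1
  x = (ℤ.+ k) ℚ./ suc l-1

^-bound : ∀ k l .{{_ : NonZero l}} n m → k ^ n ≤ m * l ^ n → ((ℤ.+ k) ℚ./ l) ^ℚ n ℚ.≤ ι m
^-bound k l@(suc l-1) n m le = ℚ.*-cancelʳ-≤-pos (ι (l ^ n)) {{positive}} (begin
  ((ℤ.+ k) ℚ./ l) ^ℚ n ℚ.* ι (l ^ n)  ≡⟨ /-^-ι k l-1 n ⟩
  ι (k ^ n)                           ≤⟨ ι-mono-≤ le ⟩
  ι (m * l ^ n)                       ≡⟨ ι-* m (l ^ n) ⟨
  ι m ℚ.* ι (l ^ n)                   ∎)
  where
  open ℚ.≤-Reasoning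
  positive = ℚ.normalize-pos (l ^ n) 1 {{_}} {{m^n≢0 l n}}

1<[1+n]/n : ∀ n .{{_ : NonZero n}} → (ℤ.+ suc n) ℚ./ n ℚ.> ℚ.1ℚ
1<[1+n]/n n@(suc n-1) = ℚ.toℚᵘ-cancel-<
  (ℚᵘ.<-respʳ-≃ (ℚᵘ.≃-sym (toℚᵘ-fromℚᵘ (mkℚᵘ (ℤ.+ suc n) n-1)))
    (*<* (subst₂ ℤ._<_ (sym (ℤ.*-identityˡ _)) (sym (ℤ.*-identityʳ _)) (ℤ.+<+ (n<1+n n)))))

-- Bernoulli's inequality (1 - j / K) (1 + 1 / K)^j ≤ 1 for K = d + j.
bernoulli : ∀ K d j → d + j ≡ K → suc K ^ j * d ≤ K ^ j * K
bernoulli K d zero    eq = ≤-trans (≤-reflexive (*-identityˡ d))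
  (≤-trans (≤-trans (m≤m+n d 0) (≤-reflexive eq)) (≤-reflexive (sym (*-identityˡ K))))
bernoulli K d (suc j) eq = begin
  suc K * suc K ^ j * d       ≡⟨ rearrange₁ K (suc K ^ j) d ⟩
  suc K ^ j * (d + K * d)     ≤⟨ *-monoʳ-≤ (suc K ^ j) (+-monoˡ-≤ (K * d) (≤-trans (m≤m+n d (suc j)) (≤-reflexive eq))) ⟩
  suc K ^ j * (K + K * d)     ≡⟨ rearrange₂ K (suc K ^ j) d ⟩
  K * (suc K ^ j * suc d)     ≤⟨ *-monoʳ-≤ K (bernoulli K (suc d) j (trans (sym (+-suc d j)) eq)) ⟩
  K * (K ^ j * K)             ≡⟨ *-assoc K (K ^ j) K ⟨
  K * K ^ j * K               ∎
  where
  open ≤-Reasoning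
  rearrange₁ : ∀ K x d → (1 + K) * x * d ≡ x * (d + K * d)
  rearrange₁ = solve-∀
  rearrange₂ : ∀ K x d → x * (K + K * d) ≡ K * (x * (1 + d))
  rearrange₂ = solve-∀

-- Bernoulli's inequality with K = 2t and d = j = t, that is, (1 + 1/(2t))^t ≤ 2.
power-doubling : ∀ t .{{_ : NonZero t}} → suc (2 * t) ^ t ≤ 2 * (2 * t) ^ t
power-doubling t = *-cancelʳ-≤ _ _ t (≤-trans (bernoulli (2 * t) t t (cong (t +_) (sym (+-identityʳ t))))
  (≤-reflexive (rearrange₁ ((2 * t) ^ t) t)))
  where
  rearrange₁ : ∀ x t → x * (2 * t) ≡ 2 * x * t
  rearrange₁ = solve-∀

^-distrib-* : ∀ x y n → (x * y) ^ n ≡ x ^ n * y ^ n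
^-distrib-* x y zero    = refl
^-distrib-* x y (suc n) = trans (cong (x * y *_) (^-distrib-* x y n)) ([m*n]*[o*p]≡[m*o]*[n*p] x y (x ^ n) (y ^ n))

-- Since n ≤ t m, (1 + 1/K)^n is at most ((1 + 1/K)^t)^m ≤ 2^m. The factor K^d fills the exponent n
-- up to t m, so that no division occurs.
power-growth : ∀ t .{{_ : NonZero t}} m n → n ≤ t * m → suc (2 * t) ^ n ≤ 2 ^ m * (2 * t) ^ n
power-growth t m n n≤ = *-cancelʳ-≤ _ _ (K ^ d) {{m^n≢0 K d {{m*n≢0 2 t}}}} (begin
  suc K ^ n * K ^ d          ≤⟨ *-monoʳ-≤ (suc K ^ n) (^-monoˡ-≤ d (n≤1+n K)) ⟩
  suc K ^ n * suc K ^ d      ≡⟨ ^-distribˡ-+-* (suc K) n d ⟨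
  suc K ^ (n + d)            ≡⟨ cong (suc K ^_) (m+[n∸m]≡n n≤) ⟩
  suc K ^ (t * m)            ≡⟨ ^-*-assoc (suc K) t m ⟨
  (suc K ^ t) ^ m            ≤⟨ ^-monoˡ-≤ m (power-doubling t) ⟩
  (2 * K ^ t) ^ m            ≡⟨ ^-distrib-* 2 (K ^ t) m ⟩
  2 ^ m * (K ^ t) ^ m        ≡⟨ cong (2 ^ m *_) (^-*-assoc K t m) ⟩
  2 ^ m * K ^ (t * m)        ≡⟨ cong (λ z → 2 ^ m * K ^ z) (m+[n∸m]≡n n≤) ⟨
  2 ^ m * K ^ (n + d)        ≡⟨ cong (2 ^ m *_) (^-distribˡ-+-* K n d) ⟩
  2 ^ m * (K ^ n * K ^ d)    ≡⟨ *-assoc (2 ^ m) (K ^ n) (K ^ d) ⟨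
  2 ^ m * K ^ n * K ^ d      ∎)
  where
  open ≤-Reasoning
  K = 2 * t
  d = t * m ∸ n

-- The maps of the proof

-- 48 is the code of the digit 0; `mod` leaves the digits used below unchanged.
word : ∀ r → String → Word (Fin (suc r))
word r = map (λ x → (Char.toℕ x ∸ 48) mod suc r) ∘ toList

-- The images were found by a computer search for sets of words of equal length
-- with a common prefix that can follow each other in any order.
g : Fin 4 × Fin 2 → Word (Fin 4)
g (0F , 0F) = word 3
  "320130231032130120310213201231032130231203210230120310213012310320130210312013210230120310213201230210"
g (0F , 1F) = word 3
  "320130231032130120310230132103120130210320123102130120310230132031230213201231032130120310213201230210"
g (1F , 0F) = word 3
  "320130231032130123102132031230132102312032130231032012302132031230132103120130210320123102132031230210"
g (1F , 1F) = word 3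
  "320130231032130123102132031230132103120130210320123021320310230132103120130231032130123102132031230210"
g (2F , 0F) = word 3
  "320130231203210230120310213012310321302312013210312301320310230120321023120130210320123102132031230210"
g (2F , 1F) = word 3
  "320130231203210230120310213012310321302312013210312301320310230120321302312013210230120310213201230210"
g (3F , 0F) = word 3
  "320130231203210230132031021301231032013023120321301231021320312302103201231021301203210230132031230210"
g (3F , 1F) = word 3
  "320130231203213012310320130210312301320310230120321023120132103123021320123102130120310230132031230210"

hᵃ : Fin 4 → Word (Fin 3)
hᵃ 0F = word 2
  "01202102012021012010210120210201210212010210120210201202101201021201210201202101201021"
hᵃ 1F = word 2
  "01202102012102120102101201021201210201202101201021012021020120210120102120121021201021"
hᵃ 2F = word 2
  "01202102012102120121020120210120102120121020120210201210212010210120102120121021201021"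
hᵃ 3F = word 2
  "01202102012102120121020120210201210212010210120102120121020120210120102120121021201021"

hᵇ : Fin 4 → Word (Fin 3)
hᵇ 0F = word 2
  "012102010212010201210120210121020102120210120212010212021012102012101202120102"
hᵇ 1F = word 2
  "012102010212010201210120212010212021012021201020121012021012102012101202120102"
hᵇ 2F = word 2
  "012102010212010201210120212010212021012102012101202101210201021202101202120102"
hᵇ 3F = word 2
  "012102010212021012102012101202101210201021201020121020102120210120212010212021"

hᶜ : Fin 4 → Word (Fin 3)
hᶜ 0F = word 2
  "01210212012101201020120210201021012102120210201202120121021202102010210121021201210120102012021020102101201020120212012101201021"
hᶜ 1F = word 2
  "01210212012101201020120212012102120210201021012010201202102010210121021201210120102101210212021020102101201020120212012101201021"
hᶜ 2F = word 2
  "01210212012101201020120212012102120210201021012102120121012010210121021202102012021201210212021020102101201020120212012101201021"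
hᶜ 3F = word 2
  "01210212012101201020120212012102120210201202120121012010210121021202102010210120102012021020102101210212021020120212012101201021"

tagged : List (Fin 4 × Fin 2)
tagged = cartesianProduct (allFin 4) (allFin 2)

tagged-complete : ∀ x → x ∈ tagged
tagged-complete (x , i) = ∈-cartesianProduct⁺ (∈-allFin x) (∈-allFin i)

module G = UniformMap proj₁ tagged tagged-complete 102 g
module Hᵃ = UniformMap id (allFin 4) ∈-allFin 86 hᵃ
module Hᵇ = UniformMap id (allFin 4) ∈-allFin 78 hᵇ
module Hᶜ = UniformMap id (allFin 4) ∈-allFin 128 hᶜ

≤! : ∀ {m n} → {T (m ≤ᵇ n)} → m ≤ n
≤! {m} {n} {m≤n} = ≤ᵇ⇒≤ m n m≤n

-- Ratio 1/2 and slack 1 are those of the source, so `g` can be iterated. For q = 102, E₁ + E₂ = 50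
-- is the largest sum that `slack` admits; for P = 64, L = 33 is the largest value that `P-large`
-- admits.
g-certificate : G.Certificate 1 2 1 64 33 19 31 2
g-certificate = record
  { uniform = tt
  ; prefixes = tt
  ; suffixes = tt
  ; synchronizing = tt
  ; shortPeriods = tt
  ; blockPeriod = tt
  ; κ≤N = ≤!
  ; κ≤D = ≤!
  ; D≤2N = ≤!
  ; E₁<q = ≤!
  ; E₂<q = ≤!
  ; L≤1+q = ≤!
  ; k≤3 = ≤!
  ; P-large = ≤!
  ; k-window = ≤!
  ; 3-window = ≤!
  ; slack = ≤!
  }

-- The ratios 7/8, 5/6 and 3/4 in this and the next two certificates are the exponents 15/8, 11/6
-- and 7/4 minus one; κ is 0 because these maps are applied only once. For the first two maps
-- `k-window` requires three blocks, for the third two.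
hᵃ-certificate : Hᵃ.Certificate 7 8 0 57 51 29 32 3
hᵃ-certificate = record
  { uniform = tt
  ; prefixes = tt
  ; suffixes = tt
  ; synchronizing = tt
  ; shortPeriods = tt
  ; blockPeriod = tt
  ; κ≤N = ≤!
  ; κ≤D = ≤!
  ; D≤2N = ≤!
  ; E₁<q = ≤!
  ; E₂<q = ≤!
  ; L≤1+q = ≤!
  ; k≤3 = ≤!
  ; P-large = ≤!
  ; k-window = ≤!
  ; 3-window = ≤!
  ; slack = ≤!
  }

hᵇ-certificate : Hᵇ.Certificate 5 6 0 46 40 39 26 3
hᵇ-certificate = record
  { uniform = tt
  ; prefixes = tt
  ; suffixes = tt
  ; synchronizing = tt
  ; shortPeriods = tt
  ; blockPeriod = tt
  ; κ≤N = ≤!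
  ; κ≤D = ≤!
  ; D≤2N = ≤!
  ; E₁<q = ≤!
  ; E₂<q = ≤!
  ; L≤1+q = ≤!
  ; k≤3 = ≤!
  ; P-large = ≤!
  ; k-window = ≤!
  ; 3-window = ≤!
  ; slack = ≤!
  }

hᶜ-certificate : Hᶜ.Certificate 3 4 0 62 48 47 44 2
hᶜ-certificate = record
  { uniform = tt
  ; prefixes = tt
  ; suffixes = tt
  ; synchronizing = tt
  ; shortPeriods = tt
  ; blockPeriod = tt
  ; κ≤N = ≤!
  ; κ≤D = ≤!
  ; D≤2N = ≤!
  ; E₁<q = ≤!
  ; E₂<q = ≤!
  ; L≤1+q = ≤!
  ; k≤3 = ≤!
  ; P-large = ≤!
  ; k-window = ≤!
  ; 3-window = ≤!
  ; slack = ≤!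
  }

g-injective : T (G.injective (≡-dec _≟_ _≟_))
g-injective = tt

-- Finite bounds replace the passage to a limit: `g` takes a source up to 4 + M = 3 + (M + 1) to one
-- up to 102 (M + 1) ≥ 5 + M. The tag `0F` is an arbitrary choice.
source-stream : ∀ M → ∃[ t ] SourceUpTo {Fin 4} (4 + M) t
source-stream zero = (_mod 4) , bounded
  where
  bounded : SourceUpTo 4 (_mod 4)
  bounded s p zero    1≤p le rep = ≤-trans 1≤p (m≤m+n p 0)
  -- The first four letters are distinct, so a nonempty overlap does not fit.
  bounded s p (suc e) 1≤p le rep = contradiction (+-cancelˡ-≡ s p 0 (trans s+p≡s (sym (+-identityʳ s)))) (≢-nonZero⁻¹ p {{>-nonZero 1≤p}})
    where
    s+p<4 : s + p + 0 < 4
    s+p<4 = ≤-trans (≤-trans (≤-reflexive (sym (+-suc (s + p) 0))) (+-monoʳ-≤ (s + p) (s≤s z≤n))) le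
    s<4 : s + 0 < 4
    s<4 = ≤-<-trans (+-monoˡ-≤ 0 (m≤m+n s p)) s+p<4
    s+p≡s : s + p ≡ s
    s+p≡s = begin
      s + p              ≡⟨ +-identityʳ (s + p) ⟨
      s + p + 0          ≡⟨ m<n⇒m%n≡m s+p<4 ⟨
      (s + p + 0) % 4    ≡⟨ fromℕ<-injective _ _ _ _ (rep 0 z<s) ⟨
      (s + 0) % 4        ≡⟨ m<n⇒m%n≡m s<4 ⟩
      s + 0              ≡⟨ +-identityʳ s ⟩
      s                  ∎
      where open ≡-Reasoning
source-stream (suc M) with t , source ← source-stream M =
  G.image w , Bounded-≤ 1 2 1 (G.image w) enough (G.Preservation.image-bounded g-certificate (suc M) w source)
  where
  w : ℕ → Fin 4 × Fin 2
  w j = t j , 0F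
  enough : 4 + suc M ≤ suc M * 102
  enough = +-mono-≤ {5} {102} ≤! (m≤m*n M 102)

funToFin-cong : ∀ {m n} {f f′ : Fin m → Fin n} → (∀ x → f x ≡ f′ x) → funToFin f ≡ funToFin f′
funToFin-cong {zero}  eq = refl
funToFin-cong {suc m} eq = cong₂ Fin.combine (eq zero) (funToFin-cong (eq ∘ suc))

-- An index below 2^m encodes one binary choice for each of the first m source letters; later
-- letters take a fixed default image.
tags : ∀ m → Fin (2 ^ m) → ℕ → Fin 2
tags m i j with j <? m
... | yes j<m = finToFun i (fromℕ< j<m)
... | no  _   = 0F

tags-toℕ : ∀ m i x → tags m i (toℕ x) ≡ finToFun i x
tags-toℕ m i x with toℕ x <? m
... | yes x<m = cong (finToFun i) (fromℕ<-toℕ x x<m)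
... | no  x≮m = contradiction (toℕ<n x) x≮m

tags-injective : ∀ m i i′ → (∀ j → j < m → tags m i j ≡ tags m i′ j) → i ≡ i′
tags-injective m i i′ eq = begin
  i                      ≡⟨ funToFin-finToFin {m} i ⟨
  funToFin {m} (finToFun i)  ≡⟨ funToFin-cong {m} (λ x → trans (sym (tags-toℕ m i x)) (trans (eq (toℕ x) (toℕ<n x)) (tags-toℕ m i′ x))) ⟩
  funToFin {m} (finToFun i′) ≡⟨ funToFin-finToFin {m} i′ ⟩
  i′                     ∎
  where open ≡-Reasoning

-- Counting the ternary words

module Growth (q : ℕ) .{{_ : NonZero q}} (h : Fin 4 → Word (Fin 3)) (p : LetterPattern) where

  module H = UniformMap id (allFin 4) ∈-allFin q h

  module _
    {N D-1 P L E₁ E₂ k : ℕ} (certificate : H.Certificate N (suc D-1) 0 P L E₁ E₂ k)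
    (injective : T (H.injective _≟_)) (avoiding : T (H.avoiding p)) (p≤ : length p ≤ suc q)
    where

    open H.Certificate certificate using (uniform)

    Good : Word (Fin 3) → Set
    Good w = (((ℤ.+ (N + suc D-1)) ℚ./ suc D-1) ⁺-Free) w × w Avoids p

    block : ℕ
    block = 102 * q

    instance
      block≢0 : NonZero block
      block≢0 = m*n≢0 102 q

    module _ (n : ℕ) where

      -- Counts the source letters whose ternary images lie entirely in the first n letters; only
      -- these carry choices.
      m : ℕ
      m = n / block

      t : ℕ → Fin 4
      -- Two maps follow, each with a margin of 3: a source up to 4 + (3 + n) = 3 + (4 + n) makes
      -- `y` a source up to 3 + n, which bounds `z` up to n.
      t = proj₁ (source-stream (3 + n))

      w : Fin (2 ^ m) → ℕ → Fin 4 × Fin 2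
      w i j = t j , tags m i j

      y : Fin (2 ^ m) → ℕ → Fin 4
      y i = G.image (w i)

      z : Fin (2 ^ m) → ℕ → Fin 3
      z i = H.image (y i)

      y-source : ∀ i → SourceUpTo (3 + n) (y i)
      y-source i = Bounded-≤ 1 2 1 (y i) (≤-trans (n≤1+n (3 + n)) (m≤m*n (4 + n) 102))
        (G.Preservation.image-bounded g-certificate (4 + n) (w i) (proj₂ (source-stream (3 + n))))

      z-bounded : ∀ i → Bounded N (suc D-1) 0 n (z i)
      z-bounded i = Bounded-≤ N (suc D-1) 0 (z i) (m≤m*n n q) (H.Preservation.image-bounded certificate n (y i) (y-source i))

      avoids : ∀ i → applyUpTo (z i) n Avoids p
      avoids i v factor (σ , inj , v≡) with s , l , le , refl ← factor-applyUpTo n factor =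
        H.avoiding-sound {p} {y i} {n} uniform avoiding p≤ (y-source i) s σ
          (≤-trans (m≤m+n s l) (≤-trans le (m≤m*n n q))) inj
          (trans (cong (applyUpTo (λ j → z i (s + j))) (sym l≡)) v≡)
        where
        l≡ : l ≡ length p
        l≡ = trans (sym (length-applyUpTo (λ j → z i (s + j)) l)) (trans (cong length v≡) (length-map σ p))

      words : List (Word (Fin 3))
      words = map (λ i → applyUpTo (z i) n) (allFin (2 ^ m))

      -- As m 102 q ≤ n, equal words give equal `y` on 102 m letters, hence equal tags on m letters,
      -- and these determine the index.
      words-distinct : ∀ {i i′} → applyUpTo (z i) n ≡ applyUpTo (z i′) n → i ≡ i′
      words-distinct {i} {i′} eq = tags-injective m i i′ λ j j<m →
        ,-injectiveʳ (G.image-injective (≡-dec _≟_ _≟_) {w i} {w i′} (G.Certificate.uniform g-certificate) g-injective m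
          (H.image-injective _≟_ {y i} {y i′} uniform injective (m * 102)
            λ x x< → applyUpTo-injective n eq x (≤-trans x< (≤-trans (≤-reflexive (*-assoc m 102 q)) (m/n*n≤m n block))))
          j j<m)

      good : All (λ v → length v ≡ n × Good v) words
      good = All.map⁺ (All.tabulate λ {i} _ →
        length-applyUpTo (z i) n , bounded⇒free {N = N} {z = z i} (z-bounded i) , avoids i)

      length-words : length words ≡ 2 ^ m
      length-words = trans (length-map _ (allFin (2 ^ m))) (length-tabulate id)

      -- Here m ≥ 1, so the remainder is at most m blocks. This is the hypothesis of `power-growth`
      -- for t = 2 block.
      n≤ : n ≥ block → n ≤ 2 * block * m
      n≤ block≤n = begin
        n                     ≡⟨ m≡m%n+[m/n]*n n block ⟩
        n % block + m * block ≤⟨ +-monoˡ-≤ (m * block) (≤-trans (<⇒≤ (m%n<n n block)) (m≤n*m block m {{>-nonZero (m≥n⇒m/n>0 block≤n)}})) ⟩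
        m * block + m * block ≡⟨ rearrange₁ m block ⟩
        2 * block * m         ∎
        where
        open ≤-Reasoning
        rearrange₁ : ∀ m q → m * q + m * q ≡ 2 * q * m
        rearrange₁ = solve-∀

    exponentiallyMany : ExponentiallyMany Good
    -- The constant is 1 + 1/(2t) with t = 2 block, the base whose n-th power `power-growth` bounds
    -- by 2^m.
    exponentiallyMany = (ℤ.+ suc K) ℚ./ K , 1<[1+n]/n K , block , λ n block≤n →
      words n , Unique.map⁺ (words-distinct n) (allFin⁺ (2 ^ m n)) , good n ,
      subst (λ l → ((ℤ.+ suc K) ℚ./ K) ^ℚ n ℚ.≤ ι l) (sym (length-words n))
        (^-bound (suc K) K n (2 ^ m n) (power-growth (2 * block) (m n) n (n≤ n block≤n)))
      where
      K = 2 * (2 * block)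
      instance
        2block≢0 : NonZero (2 * block)
        2block≢0 = m*n≢0 2 block
        K≢0 : NonZero K
        K≢0 = m*n≢0 2 (2 * block)

theorem16 : ExponentiallyMany {Fin 3} (λ w → ((ℤ.+ 15 ℚ./ 8) ⁺-Free) w × w Avoids abaca) ×
    ExponentiallyMany {Fin 3} (λ w → ((ℤ.+ 11 ℚ./ 6) ⁺-Free) w × w Avoids abcab) ×
    ExponentiallyMany {Fin 3} (λ w → ((ℤ.+ 7 ℚ./ 4) ⁺-Free) w × w Avoids abacbc)
theorem16 =
  Growth.exponentiallyMany 86  hᵃ abaca  hᵃ-certificate tt tt ≤! ,
  Growth.exponentiallyMany 78  hᵇ abcab  hᵇ-certificate tt tt ≤! ,
  Growth.exponentiallyMany 128 hᶜ abacbc hᶜ-certificate tt tt ≤!
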